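{- Let $F$ be a graph and $k\ge 2$ be an integer. If every $(F,C_4,C_3)$-free graph is $k$-colorable, then $\chi(G)\le\frac{k}{2}\omega(G)$ for every $(F,C_4,\text{bull})$-free graph $G$, and $\chi(G)\le\omega(G)+k-2$ for every $(F,C_4,\text{hammer})$-free graph $G$.
   Context: All graphs are finite and simple. $\omega(G)$ is the clique number and $\chi(G)$ the chromatic number of $G$. For graphs $H_1,\dots,H_t$, a graph $G$ is $(H_1,\dots,H_t)$-free if no induced subgraph of $G$ is isomorphic to any $H_i$. $C_t$ is the cycle on $t$ vertices. A bull is the 5-vertex graph consisting of a triangle with two disjoint pendant edges (i.e. pendant edges attached at two distinct vertices of the triangle). A hammer is the 5-vertex graph obtained by identifying an endvertex of a path on 3 vertices with a vertex of a triangle. -}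

module Defs where

open import Data.Fin using (Fin; toℕ; #_)
open import Data.Fin.Properties using (_≟_; all?; any?)
open import Data.Fin.Subset using (Subset; _∈_; ∣_∣; ⊥)
open import Data.Fin.Subset.Properties using (_∈?_; anySubset?; ∣p∣≤n; ∣⊥∣≡0; ∉⊥)
open import Data.List using (List; []; _∷_)
open import Data.List.Relation.Unary.All using (All)
import Data.List.Membership.DecPropositional as ListMembership
open import Data.Nat using (ℕ; zero; suc; _≤_; z≤n; s≤s; NonZero)
import Data.Nat as ℕ
open import Data.Nat.DivMod using (_%_)
open import Data.Nat.Properties using (≤∧≢⇒<)
open import Data.Product using (∃; _×_; _,_; proj₁; proj₂)
open import Data.Product.Properties using (≡-dec)
open import Data.Sum using (_⊎_; swap)
open import Data.Vec using (Vec; []; _∷_; lookup; tabulate)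
open import Data.Vec.Properties using (lookup∘tabulate)
open import Function using (_∘_; _⇔_; Injective; id)
open import Level using (0ℓ)
open import Relation.Binary using (Rel; Decidable; Symmetric; Irreflexive)
open import Relation.Binary.PropositionalEquality using (_≡_; _≢_; refl; sym; trans; subst)
open import Relation.Nullary using (¬_; Dec; yes; no; contradiction)
open import Relation.Nullary.Decidable using (map′; ¬?; _×-dec_; _⊎-dec_; _→-dec_)
import Relation.Unary as U

-- Every finite simple graph is isomorphic to one with vertex set Fin order and
-- decidable adjacency, so only these are considered.

record Graph : Set₁ where
  field
    order  : ℕ
    Adj    : Rel (Fin order) 0ℓ
    adj?   : Decidable Adj
    symm   : Symmetric Adj
    irrefl : Irreflexive _≡_ Adj

  Vertex : Set
  Vertex = Fin order

open Graph public using (Vertex)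

-- An induced subgraph of G isomorphic to H is the image of such a map.

record InducedCopy (H G : Graph) : Set where
  private
    module H = Graph H
    module G = Graph G
  field
    to        : Vertex H → Vertex G
    injective : Injective _≡_ _≡_ to
    adj⇔      : ∀ u v → H.Adj u v ⇔ G.Adj (to u) (to v)

infix 4 _-free_

_-free_ : List Graph → Graph → Set₁
Hs -free G = All (λ H → ¬ InducedCopy H G) Hs

-- The simple graph underlying a relation: symmetrise it and drop the loops.

fromRel : ∀ {n} {R : Rel (Fin n) 0ℓ} → Decidable R → Graph
fromRel {n} {R} R? = record
  { order  = n
  ; Adj    = λ u v → u ≢ v × (R u v ⊎ R v u)
  ; adj?   = λ u v → ¬? (u ≟ v) ×-dec (R? u v ⊎-dec R? v u)
  ; symm   = λ (u≢v , r) → u≢v ∘ sym , swap r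
  ; irrefl = λ u≡v (u≢v , _) → u≢v u≡v
  }

fromEdges : ∀ n → List (Fin n × Fin n) → Graph
fromEdges n es = fromRel λ u v → (u , v) ∈ₗ? es
  where open ListMembership (≡-dec (_≟_ {n}) (_≟_ {n})) renaming (_∈?_ to _∈ₗ?_)

-- The cycle on t vertices when 3 ≤ t (degenerate for smaller t).

C : (t : ℕ) .{{_ : NonZero t}} → Graph
C t = fromRel {t} λ i j → suc (toℕ i) % t ℕ.≟ toℕ j

bull : Graph
bull = fromEdges 5
  ( (# 0 , # 1) ∷ (# 1 , # 2) ∷ (# 2 , # 0)
  ∷ (# 0 , # 3) ∷ (# 1 , # 4) ∷ [] )

hammer : Graph
hammer = fromEdges 5
  ( (# 0 , # 1) ∷ (# 1 , # 2) ∷ (# 2 , # 0)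
  ∷ (# 2 , # 3) ∷ (# 3 , # 4) ∷ [] )

module _ (G : Graph) where
  open Graph G using (order; Adj)

  IsProper : ∀ {k} → (Vertex G → Fin k) → Set
  IsProper c = ∀ u v → Adj u v → c u ≢ c v

  Colorable : ℕ → Set
  Colorable k = ∃ λ (c : Vertex G → Fin k) → IsProper c

  IsChromaticNumber : ℕ → Set
  IsChromaticNumber m = Colorable m × (∀ k → Colorable k → m ≤ k)

  IsClique : Subset order → Set
  IsClique S = ∀ u v → u ∈ S → v ∈ S → u ≢ v → Adj u v

  HasClique : ℕ → Set
  HasClique m = ∃ λ S → IsClique S × ∣ S ∣ ≡ m

  IsCliqueNumber : ℕ → Set
  IsCliqueNumber m = HasClique m × (∀ k → HasClique k → k ≤ m)

-- Both numbers exist, by exhaustive search.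

private
  anyVec? : ∀ {k} n {P : U.Pred (Vec (Fin k) n) 0ℓ} → U.Decidable P → Dec (∃ P)
  anyVec? zero    P? = map′ (λ p → [] , p) (λ { ([] , p) → p }) (P? [])
  anyVec? (suc n) P? =
    map′ (λ (x , xs , p) → x ∷ xs , p) (λ { (x ∷ xs , p) → x , xs , p })
         (any? λ x → anyVec? n (λ xs → P? (x ∷ xs)))

  least : ∀ {P : U.Pred ℕ 0ℓ} → U.Decidable P → ∀ n → P n →
          ∃ λ m → P m × (∀ k → P k → m ≤ k)
  least P? zero p = 0 , p , λ _ _ → z≤n
  least P? (suc n) p with P? 0
  ... | yes p₀ = 0 , p₀ , λ _ _ → z≤n
  ... | no ¬p₀ with least (P? ∘ suc) n p
  ...   | m , pm , min = suc m , pm , λ where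
          zero    p₀ → contradiction p₀ ¬p₀
          (suc k) pk → s≤s (min k pk)

  greatest : ∀ {P : U.Pred ℕ 0ℓ} → U.Decidable P → P 0 → ∀ n → (∀ k → P k → k ≤ n) →
             ∃ λ m → P m × (∀ k → P k → k ≤ m)
  greatest P? p₀ zero    bound = 0 , p₀ , bound
  greatest {P} P? p₀ (suc n) bound with P? (suc n)
  ... | yes p = suc n , p , bound
  ... | no ¬p = greatest P? p₀ n λ k pk →
          ℕ.s≤s⁻¹ (≤∧≢⇒< (bound k pk) λ k≡ → ¬p (subst P k≡ pk))

module _ (G : Graph) where
  open Graph G using (order; adj?; irrefl)

  isProper? : ∀ {k} (c : Vertex G → Fin k) → Dec (IsProper G c)
  isProper? c = all? λ u → all? λ v → adj? u v →-dec ¬? (c u ≟ c v)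

  colorable? : ∀ k → Dec (Colorable G k)
  colorable? k = map′
    (λ (xs , p) → lookup xs , p)
    (λ (c , p) → tabulate c , λ u v a e →
      p u v a (trans (sym (lookup∘tabulate c u)) (trans e (lookup∘tabulate c v))))
    (anyVec? order (isProper? ∘ lookup))

  isClique? : ∀ S → Dec (IsClique G S)
  isClique? S = all? λ u → all? λ v →
    (u ∈? S) →-dec ((v ∈? S) →-dec (¬? (u ≟ v) →-dec adj? u v))

  hasClique? : ∀ m → Dec (HasClique G m)
  hasClique? m = anySubset? λ S → isClique? S ×-dec (∣ S ∣ ℕ.≟ m)

  chromaticNumber : ∃ (IsChromaticNumber G)
  chromaticNumber = least colorable? order (id , λ u v a u≡v → irrefl u≡v a)

  cliqueNumber : ∃ (IsCliqueNumber G)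
  cliqueNumber = greatest hasClique?
    (⊥ , (λ _ _ u∈⊥ _ _ → contradiction u∈⊥ ∉⊥) , ∣⊥∣≡0 order)
    order (λ { _ (S , _ , refl) → ∣p∣≤n S })

  χ : ℕ
  χ = proj₁ chromaticNumber

  ω : ℕ
  ω = proj₁ cliqueNumber

  χ-isChromaticNumber : IsChromaticNumber G χ
  χ-isChromaticNumber = proj₂ chromaticNumber

  ω-isCliqueNumber : IsCliqueNumber G ω
  ω-isCliqueNumber = proj₂ cliqueNumber

{-# OPTIONS --safe #-}
module Submission where

-- A separation consists of a clique Q and a nonempty proper set X of vertices that is complete to Q
-- and anticomplete to the rest. Colour G − X with f(ω) colours and then X with f(ω − |Q|) of those
-- that do not occur on Q: if f is strictly increasing, only unseparated graphs remain. Take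
-- f(w) = w + k − 2 for the hammer and f(w) = ⌊kw/2⌋ for the bull; graphs without triangles are
-- covered by the hypothesis on k.
--
-- Order the vertices by inclusion of closed neighbourhoods. In the hammer-free case a maximal
-- vertex that lies in a triangle yields a separation. In the unseparated bull-free case every
-- vertex is maximal, every triangle contains two twins (vertices with equal closed neighbourhoods)
-- and every vertex has a neighbour that is not its twin. One vertex from each twin class then
-- induces a triangle-free graph, and removing these vertices lowers the clique number by two.

open import Defs
open import Data.Bool using (if_then_else_)
open import Data.Empty using (⊥; ⊥-elim)
open import Data.Fin using (Fin; zero; suc; #_; inject≤; splitAt; _↑ˡ_; _↑ʳ_) renaming (_<_ to _<ᶠ_)
open import Data.Fin.Induction using (spo-noetherian) renaming (<-wellFounded to <ᶠ-wellFounded)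
open import Data.Fin.Properties
  using (_≟_; _<?_; <-cmp; all?; any?; injective⇒≤; inject≤-injective;
         ↑ˡ-injective; ↑ʳ-injective; splitAt-↑ˡ; splitAt-↑ʳ)
open import Data.Fin.Subset using (Subset; ⁅_⁆; _∪_; ∣_∣) renaming (⊥ to ∅; _∈_ to _∈ₛ_)
open import Data.Fin.Subset.Properties
  using (∉⊥; x∈⁅x⁆; x∈⁅y⁆⇒x≡y; x∈p∪q⁻; x∈p∪q⁺; q⊆p∪q; p⊂q⇒∣p∣<∣q∣)
open import Data.List using (List; []; _∷_; _++_; length; lookup; map; filter; allFin; tabulate)
import Data.List.Membership.DecPropositional as DecMembership
open import Data.List.Membership.Propositional using (_∈_; _∉_; find)
open import Data.List.Membership.Propositional.Properties
  using (∈-filter⁺; ∈-filter⁻; ∈-allFin; ∈-lookup)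
open import Data.List.Properties using (length-map; length-++; filter-notAll; length-tabulate)
open import Data.List.Relation.Unary.All as All using (All; []; _∷_)
import Data.List.Relation.Unary.All.Properties as Allₚ
open import Data.List.Relation.Unary.AllPairs using (AllPairs; []; _∷_)
import Data.List.Relation.Unary.AllPairs.Properties as AllPairsₚ
open import Data.List.Relation.Unary.Any as Any using (here; there; index)
open import Data.List.Relation.Unary.Any.Properties using (lookup-index)
open import Data.List.Relation.Unary.Unique.Propositional using (Unique)
open import Data.List.Relation.Unary.Unique.Propositional.Properties
  using (allFin⁺) renaming (filter⁺ to Unique-filter⁺)
open import Data.Nat using (ℕ; zero; suc; _+_; _*_; _∸_; _≤_; _<_; z≤n; s≤s; ⌊_/2⌋; ⌈_/2⌉)
open import Data.Nat.Induction using (<-wellFounded)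
import Data.Nat.Properties as ℕ
open import Data.Product using (_×_; _,_; ∃; ∃₂; proj₁; proj₂)
open import Data.Sum as Sum using (_⊎_; inj₁; inj₂; [_,_]′)
import Data.Vec as Vec
open Vec using ([]; _∷_)
open import Function using (_∘_; id; flip; mk⇔; Injective; Equivalence)
open import Induction.WellFounded using (Acc; acc)
open import Level using (0ℓ)
open import Relation.Binary using (IsStrictPartialOrder; tri<; tri≈; tri>)
open import Relation.Binary.PropositionalEquality
  using (_≡_; _≢_; refl; sym; trans; cong; subst; subst₂; isEquivalence; resp₂)
open import Relation.Nullary using (¬_; Dec; yes; no; does; contradiction)
open import Relation.Nullary.Decidable using (¬?; decidable-stable; _×-dec_; _⊎-dec_; _→-dec_; from-yes)
open import Relation.Unary using (Pred; ∁) renaming (Decidable to Decidable₁)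

-- Injections into a set of colours that avoid a list.

lookup-injective : ∀ {A : Set} {xs : List A} → Unique xs → ∀ i j → lookup xs i ≡ lookup xs j → i ≡ j
lookup-injective (_ ∷ _)  zero    zero    _ = refl
lookup-injective (x∉ ∷ _) zero    (suc j) e = contradiction e (All.lookup x∉ (∈-lookup j))
lookup-injective (x∉ ∷ _) (suc i) zero    e = contradiction (sym e) (All.lookup x∉ (∈-lookup i))
lookup-injective (_ ∷ u)  (suc i) (suc j) e = cong suc (lookup-injective u i j e)

-- If every colour occurred in `l`, sending a colour to its position would inject `Fin n` into a
-- smaller set.
fresh : ∀ {n} (l : List (Fin n)) → length l < n → ∃ (_∉ l)
fresh {n} l short with any? (λ c → ¬? (DecMembership._∈?_ _≟_ c l))
... | yes found = found
... | no ¬found = contradiction (injective⇒≤ {f = λ c → index (all∈ c)} index-inj) (ℕ.<⇒≱ short)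
  where
  all∈ : ∀ c → c ∈ l
  all∈ c = decidable-stable (DecMembership._∈?_ _≟_ c l) (λ c∉ → ¬found (c , c∉))

  index-inj : ∀ {c d} → index (all∈ c) ≡ index (all∈ d) → c ≡ d
  index-inj {c} {d} e = trans (lookup-index (all∈ c))
    (trans (cong (lookup l) e) (sym (lookup-index (all∈ d))))

-- Every chosen colour joins the list to be avoided, which makes the map injective.
avoiding : ∀ m {n} (l : List (Fin n)) → m + length l ≤ n →
           ∃ λ (g : Fin m → Fin n) → Injective _≡_ _≡_ g × (∀ i → g i ∉ l)
avoiding zero    l _ = (λ ()) , (λ {}) , λ ()
avoiding (suc m) {n} l m+l<n
  with c , c∉l ← fresh l (ℕ.≤-trans (s≤s (ℕ.m≤n+m _ m)) m+l<n)
  with g , g-inj , g∉ ← avoiding m (c ∷ l) (subst (_≤ n) (sym (ℕ.+-suc m (length l))) m+l<n)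
  = g′ , g′-inj , g′∉
  where
  g′ : Fin (suc m) → _
  g′ zero    = c
  g′ (suc i) = g i

  g′-inj : Injective _≡_ _≡_ g′
  g′-inj {zero}  {zero}  _ = refl
  g′-inj {zero}  {suc j} e = contradiction (here (sym e)) (g∉ j)
  g′-inj {suc i} {zero}  e = contradiction (here e) (g∉ i)
  g′-inj {suc i} {suc j} e = cong suc (g-inj e)

  g′∉ : ∀ i → g′ i ∉ l
  g′∉ zero    = c∉l
  g′∉ (suc i) = g∉ i ∘ there

-- Cliques as lists, and induced subgraphs.

module _ (G : Graph) where
  open Graph G using (Adj)

  -- Lists of pairwise adjacent vertices stand for cliques, as they are easily concatenated;
  -- irreflexivity makes their entries distinct. An upper bound, unlike the clique number itself,
  -- passes unchanged to induced subgraphs.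
  CliqueBound : ℕ → Set
  CliqueBound w = ∀ (l : List (Vertex G)) → AllPairs Adj l → length l ≤ w

module _ (G : Graph) {P : Pred (Vertex G) 0ℓ} (P? : Decidable₁ P) where
  private module G = Graph G

  private
    vertices : List (Vertex G)
    vertices = filter P? (allFin G.order)

  -- The chosen vertices are renumbered by their positions in the filtered list, so that the vertex
  -- set is again some `Fin n`.
  induced : Graph
  induced = record
    { order  = length vertices
    ; Adj    = λ i j → G.Adj (lookup vertices i) (lookup vertices j)
    ; adj?   = λ i j → G.adj? (lookup vertices i) (lookup vertices j)
    ; symm   = G.symm
    ; irrefl = λ i≡j → G.irrefl (cong (lookup vertices) i≡j)
    }

  ι : Vertex induced → Vertex G
  ι = lookup vertices

  ι-injective : Injective _≡_ _≡_ ι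
  ι-injective = lookup-injective (Unique-filter⁺ P? (allFin⁺ G.order)) _ _

  ι-∈ : ∀ i → P (ι i)
  ι-∈ i = proj₂ (∈-filter⁻ P? {xs = allFin G.order} (∈-lookup i))

  preimage : ∀ {v} → P v → ∃ λ i → ι i ≡ v
  preimage {v} p = let v∈ = ∈-filter⁺ P? (∈-allFin v) p in index v∈ , sym (lookup-index v∈)

  order-induced-< : ∀ {v} → ¬ P v → Graph.order induced < G.order
  order-induced-< {v} ¬p = subst (length vertices <_) (length-tabulate (λ i → i))
    (filter-notAll P? (allFin G.order) (Any.map (λ e p → ¬p (subst P (sym e) p)) (∈-allFin v)))

  induced-copy : ∀ {H} → InducedCopy H induced → InducedCopy H G
  induced-copy c = record
    { to = ι ∘ to ; injective = injective ∘ ι-injective ; adj⇔ = adj⇔ }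
    where open InducedCopy c

  induced-free : ∀ {Hs} → Hs -free G → Hs -free induced
  induced-free = All.map (_∘ induced-copy)

  ι-clique : ∀ {l} → AllPairs (Graph.Adj induced) l → AllPairs G.Adj (map ι l)
  ι-clique = AllPairsₚ.map⁺

  induced-CliqueBound : ∀ {w} → CliqueBound G w → CliqueBound induced w
  induced-CliqueBound {w} bound l c = subst (_≤ w) (length-map ι l) (bound (map ι l) (ι-clique c))

module _ {G : Graph} where
  open Graph G using (Adj; irrefl; symm)

  clique-of : ∀ {Q : Pred (Vertex G) 0ℓ} {l} → Unique l → All Q l →
              (∀ {u v} → Q u → Q v → u ≢ v → Adj u v) → AllPairs Adj l
  clique-of []       []       _  = []
  clique-of (x∉ ∷ u) (q ∷ qs) Q-clique =
    All.zipWith (λ (q′ , x≢y) → Q-clique q q′ x≢y) (qs , x∉) ∷ clique-of u qs Q-clique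

  clique-adjacent : ∀ {l} → AllPairs Adj l → ∀ {u v} → u ∈ l → v ∈ l → u ≢ v → Adj u v
  clique-adjacent (_ ∷ _) (here refl) (here refl) u≢v = contradiction refl u≢v
  clique-adjacent (a ∷ _) (here refl) (there v∈)  _   = All.lookup a v∈
  clique-adjacent (a ∷ _) (there u∈)  (here refl) _   = symm (All.lookup a u∈)
  clique-adjacent (_ ∷ c) (there u∈)  (there v∈)  u≢v = clique-adjacent c u∈ v∈ u≢v

  private
    clique-subset : (l : List (Vertex G)) → Subset (Graph.order G)
    clique-subset []      = ∅
    clique-subset (v ∷ l) = ⁅ v ⁆ ∪ clique-subset l

    ∈-subset⁻ : ∀ l {u} → u ∈ₛ clique-subset l → u ∈ l
    ∈-subset⁻ []      u∈ = contradiction u∈ ∉⊥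
    ∈-subset⁻ (v ∷ l) u∈ with x∈p∪q⁻ ⁅ v ⁆ (clique-subset l) u∈
    ... | inj₁ u∈v = here (x∈⁅y⁆⇒x≡y v u∈v)
    ... | inj₂ u∈l = there (∈-subset⁻ l u∈l)

    ∣subset∣ : ∀ {l} → AllPairs Adj l → length l ≤ ∣ clique-subset l ∣
    ∣subset∣ []      = z≤n
    ∣subset∣ {v ∷ l} (v~l ∷ c) = ℕ.≤-<-trans (∣subset∣ c)
      (p⊂q⇒∣p∣<∣q∣ (q⊆p∪q ⁅ v ⁆ (clique-subset l) , v , x∈p∪q⁺ (inj₁ (x∈⁅x⁆ v)) ,
        λ v∈ → irrefl refl (All.lookup v~l (∈-subset⁻ l v∈))))

  ω-CliqueBound : CliqueBound G (ω G)
  ω-CliqueBound l c = ℕ.≤-trans (∣subset∣ c) (proj₂ (ω-isCliqueNumber G) _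
    (clique-subset l , (λ u v u∈ v∈ → clique-adjacent c (∈-subset⁻ l u∈) (∈-subset⁻ l v∈)) , refl))

-- Combining colourings of a vertex set and its complement.

Colorable-mono : ∀ G {m n} → m ≤ n → Colorable G m → Colorable G n
Colorable-mono G m≤n (c , proper) =
  (λ v → inject≤ (c v) m≤n) , λ u v u~v → proper u v u~v ∘ inject≤-injective m≤n m≤n (c u) (c v)

module _ {G : Graph} {P : Pred (Vertex G) 0ℓ} (P? : Decidable₁ P) where
  open Graph G using (Adj)

  private
    preimage-adj : ∀ {Q : Pred (Vertex G) 0ℓ} (Q? : Decidable₁ Q) {u v} (p : Q u) (q : Q v) →
      Adj u v → Graph.Adj (induced G Q?) (proj₁ (preimage G Q? p)) (proj₁ (preimage G Q? q))
    preimage-adj Q? p q = subst₂ Adj (sym (proj₂ (preimage G Q? p))) (sym (proj₂ (preimage G Q? q)))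

  Colorable-+ : ∀ {m n} → Colorable (induced G P?) m → Colorable (induced G (¬? ∘ P?)) n →
                Colorable G (m + n)
  Colorable-+ {m} {n} (c , proper) (d , proper′) = (λ v → color v (P? v)) ,
    λ u v → separates u v (P? u) (P? v)
    where
    color : ∀ v → Dec (P v) → Fin (m + n)
    color v (yes p) = c (proj₁ (preimage G P? p)) ↑ˡ n
    color v (no ¬p) = m ↑ʳ d (proj₁ (preimage G (¬? ∘ P?) ¬p))

    ↑ˡ≢↑ʳ : ∀ (i : Fin m) (j : Fin n) → i ↑ˡ n ≢ m ↑ʳ j
    ↑ˡ≢↑ʳ i j e with () ← trans (sym (splitAt-↑ˡ m i n)) (trans (cong (splitAt m) e) (splitAt-↑ʳ m n j))

    separates : ∀ u v p q → Adj u v → color u p ≢ color v q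
    separates u v (yes p) (yes q) a = proper _ _ (preimage-adj P? p q a) ∘ ↑ˡ-injective n _ _
    separates u v (yes p) (no ¬q) a = ↑ˡ≢↑ʳ _ _
    separates u v (no ¬p) (yes q) a = ↑ˡ≢↑ʳ _ _ ∘ sym
    separates u v (no ¬p) (no ¬q) a = proper′ _ _ (preimage-adj (¬? ∘ P?) ¬p ¬q a) ∘ ↑ʳ-injective m _ _

  -- Every edge that leaves `P` ends in `q`, so it is enough to rename the colours of `P`
  -- injectively into those that the colouring `d` of the rest does not use on `q`.
  Colorable-glue : ∀ {m n} (q : List (Vertex G)) → All (∁ P) q → m + length q ≤ n →
    (∀ {u v} → P u → ¬ P v → Adj u v → v ∈ q) →
    Colorable (induced G P?) m → Colorable (induced G (¬? ∘ P?)) n → Colorable G n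
  Colorable-glue {m} {n} q ∁q fits boundary (c , proper) (d , proper′) =
    (λ v → color v (P? v)) , λ u v → separates u v (P? u) (P? v)
    where
    d′ : ∀ {v} → ¬ P v → Fin n
    d′ ¬p = d (proj₁ (preimage G (¬? ∘ P?) ¬p))

    length-reduce : ∀ {q} (∁q : All (∁ P) q) → length (All.reduce (λ {v} → d′ {v}) ∁q) ≡ length q
    length-reduce []       = refl
    length-reduce (_ ∷ ∁q) = cong suc (length-reduce ∁q)

    ∈-reduce : ∀ {v q} (∁q : All (∁ P) q) (¬p : ¬ P v) → v ∈ q → d′ ¬p ∈ All.reduce (λ {v} → d′ {v}) ∁q
    -- `¬p` and the stored `¬p′` may be different proofs; their preimages lie over the same vertex,
    -- so injectivity of `ι` identifies the colours.
    ∈-reduce (¬p′ ∷ _) ¬p (here refl) = here (cong d (ι-injective G (¬? ∘ P?)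
      (trans (proj₂ (preimage G (¬? ∘ P?) ¬p)) (sym (proj₂ (preimage G (¬? ∘ P?) ¬p′))))))
    ∈-reduce (_ ∷ ∁q) ¬p (there v∈) = there (∈-reduce ∁q ¬p v∈)

    palette = avoiding m (All.reduce (λ {v} → d′ {v}) ∁q)
      (subst (λ k → m + k ≤ n) (sym (length-reduce ∁q)) fits)

    g = proj₁ palette

    color : ∀ v → Dec (P v) → Fin n
    color v (yes p) = g (c (proj₁ (preimage G P? p)))
    color v (no ¬p) = d′ ¬p

    crossing : ∀ {u v} (p : P u) (¬q : ¬ P v) → Adj u v → color u (yes p) ≢ color v (no ¬q)
    crossing p ¬q a e = proj₂ (proj₂ palette) _ (subst (_∈ _) (sym e) (∈-reduce ∁q ¬q (boundary p ¬q a)))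

    separates : ∀ u v p q → Adj u v → color u p ≢ color v q
    separates u v (yes p) (yes q) a = proper _ _ (preimage-adj P? p q a) ∘ proj₁ (proj₂ palette)
    separates u v (yes p) (no ¬q) a = crossing p ¬q a
    separates u v (no ¬p) (yes q) a = crossing q ¬p (Graph.symm G a) ∘ sym
    separates u v (no ¬p) (no ¬q) a = proper′ _ _ (preimage-adj (¬? ∘ P?) ¬p ¬q a)

-- Induced copies and separations.

AllPairs-tabulate⁻ : ∀ {A : Set} {R : A → A → Set} {n} {f : Fin n → A} →
                     AllPairs R (tabulate f) → ∀ {i j} → i <ᶠ j → R (f i) (f j)
AllPairs-tabulate⁻ {n = suc n} (r ∷ rs) {zero}  {suc j} _         = Allₚ.tabulate⁻ r j
AllPairs-tabulate⁻ {n = suc n} (r ∷ rs) {suc i} {suc j} (s≤s i<j) = AllPairs-tabulate⁻ rs i<j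

module _ (G : Graph) where
  private module G = Graph G

  NonAdjacent : Vertex G → Vertex G → Set
  NonAdjacent u v = u ≢ v × ¬ G.Adj u v

  module _ (H : Graph) (t : Vertex H → Vertex G) where
    private module H = Graph H

    -- For a concrete `H` the adjacency test computes, so `copy` asks for exactly the upper triangle
    -- of the adjacency matrix.
    Matches : Vertex H → Vertex H → Set
    Matches i j = if does (H.adj? i j) then G.Adj (t i) (t j) else NonAdjacent (t i) (t j)

    private
      Agree : Vertex H → Vertex H → Set
      Agree i j = H.Adj i j × G.Adj (t i) (t j) ⊎ ¬ H.Adj i j × NonAdjacent (t i) (t j)

      agree : ∀ i j → Matches i j → Agree i j
      agree i j m with H.adj? i j
      ... | yes a = inj₁ (a , m)
      ... | no ¬a = inj₂ (¬a , m)

      agree-sym : ∀ {i j} → Agree i j → Agree j i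
      agree-sym = Sum.map (λ (a , b) → H.symm a , G.symm b)
                          (λ (¬a , ≢ , ¬b) → ¬a ∘ H.symm , ≢ ∘ sym , ¬b ∘ G.symm)

    copy : AllPairs Matches (allFin H.order) → InducedCopy H G
    copy matches = record { to = t ; injective = inj _ _ ; adj⇔ = λ i j → mk⇔ (to i j) (from i j) }
      where
      compare : ∀ i j → i ≡ j ⊎ Agree i j
      compare i j with <-cmp i j
      ... | tri< i<j _ _ = inj₂ (agree i j (AllPairs-tabulate⁻ matches i<j))
      ... | tri≈ _ i≡j _ = inj₁ i≡j
      ... | tri> _ _ j<i = inj₂ (agree-sym (agree j i (AllPairs-tabulate⁻ matches j<i)))

      inj : ∀ i j → t i ≡ t j → i ≡ j
      inj i j e with compare i j
      ... | inj₁ i≡j = i≡j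
      ... | inj₂ (inj₁ (_ , b)) = contradiction b (G.irrefl e)
      ... | inj₂ (inj₂ (_ , ≢ , _)) = contradiction e ≢

      to : ∀ i j → H.Adj i j → G.Adj (t i) (t j)
      to i j a with compare i j
      ... | inj₁ i≡j = contradiction a (H.irrefl i≡j)
      ... | inj₂ (inj₁ (_ , b)) = b
      ... | inj₂ (inj₂ (¬a , _)) = contradiction a ¬a

      from : ∀ i j → G.Adj (t i) (t j) → H.Adj i j
      from i j b with compare i j
      ... | inj₁ i≡j = contradiction b (G.irrefl (cong t i≡j))
      ... | inj₂ (inj₁ (a , _)) = a
      ... | inj₂ (inj₂ (_ , _ , ¬b)) = contradiction b ¬b

-- `X` and `Q` are disjoint because `complete` would otherwise give a loop. `Q` may be empty, and
-- `outside` may lie in `Q`.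
record Separation (G : Graph) : Set₁ where
  open Graph G using (Adj)
  field
    {X Q}    : Pred (Vertex G) 0ℓ
    X?       : Decidable₁ X
    Q?       : Decidable₁ Q
    inside   : ∃ X
    outside  : ∃ λ v → ¬ X v
    clique   : ∀ {u v} → Q u → Q v → u ≢ v → Adj u v
    complete : ∀ {u v} → X u → Q v → Adj u v
    boundary : ∀ {u v} → X u → Adj u v → X v ⊎ Q v

Triangle : Graph → Set
Triangle G = ∃ λ a → ∃ λ b → ∃ λ c → Adj a b × Adj b c × Adj c a
  where open Graph G using (Adj)

-- Closed neighbourhoods ordered by inclusion.

module Neighbourhoods (G : Graph) where
  open Graph G using (order; symm; irrefl; adj?) renaming (Adj to infix 4 _~_) public

  V : Set
  V = Vertex G

  infix 4 _∈N[_] _∉N[_] _∈N[_]? _⊑_ _⊑?_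

  _∈N[_] _∉N[_] : V → V → Set
  u ∈N[ v ] = u ≡ v ⊎ v ~ u
  u ∉N[ v ] = ¬ u ∈N[ v ]

  _∈N[_]? : ∀ u v → Dec (u ∈N[ v ])
  u ∈N[ v ]? = (u ≟ v) ⊎-dec adj? v u

  _⊑_ : V → V → Set
  u ⊑ v = ∀ x → x ∈N[ u ] → x ∈N[ v ]

  _⊑?_ : ∀ u v → Dec (u ⊑ v)
  u ⊑? v = all? λ x → (x ∈N[ u ]?) →-dec (x ∈N[ v ]?)

  Maximal : V → Set
  Maximal v = ∀ u → v ⊑ u → u ⊑ v

  Twins : V → V → Set
  Twins u v = u ⊑ v × v ⊑ u

  ∈N-sym : ∀ {u v} → u ∈N[ v ] → v ∈N[ u ]
  ∈N-sym = Sum.map sym symm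

  ~⇒≢ : ∀ {u v} → u ~ v → u ≢ v
  ~⇒≢ u~v u≡v = irrefl u≡v u~v

  ∉N⇒≢ : ∀ {u v} → u ∉N[ v ] → v ≢ u
  ∉N⇒≢ u∉ = u∉ ∘ inj₁ ∘ sym

  ∉N⇒≁ : ∀ {u v} → u ∉N[ v ] → ¬ v ~ u
  ∉N⇒≁ u∉ = u∉ ∘ inj₂

  ∈N∧≢⇒~ : ∀ {u v} → u ∈N[ v ] → v ≢ u → v ~ u
  ∈N∧≢⇒~ (inj₁ u≡v) v≢u = contradiction (sym u≡v) v≢u
  ∈N∧≢⇒~ (inj₂ v~u) _   = v~u

  ⊑-witness : ∀ {u v} → ¬ u ⊑ v → ∃ λ x → x ∈N[ u ] × x ∉N[ v ]
  ⊑-witness {u} {v} u⋢v with any? (λ x → (x ∈N[ u ]?) ×-dec ¬? (x ∈N[ v ]?))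
  ... | yes found = found
  ... | no ¬found = contradiction
    (λ x x∈ → decidable-stable (x ∈N[ v ]?) (λ x∉ → ¬found (x , x∈ , x∉))) u⋢v

  ⊑-witness-~ : ∀ {u v} → u ~ v → ¬ u ⊑ v → ∃ λ x → u ~ x × x ∉N[ v ]
  ⊑-witness-~ u~v u⋢v with ⊑-witness u⋢v
  ... | x , inj₁ refl , x∉ = contradiction (inj₂ (symm u~v)) x∉
  ... | x , inj₂ u~x  , x∉ = x , u~x , x∉

  private
    _⊏_ : V → V → Set
    u ⊏ v = u ⊑ v × ¬ v ⊑ u

    ⊏-isStrictPartialOrder : IsStrictPartialOrder _≡_ _⊏_
    ⊏-isStrictPartialOrder = record
      { isEquivalence = isEquivalence
      ; irrefl        = λ { refl (u⊑u , u⋢u) → u⋢u u⊑u }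
      ; trans         = λ (u⊑v , v⋢u) (v⊑w , w⋢v) →
                          (λ x → v⊑w x ∘ u⊑v x) , λ w⊑u → w⋢v (λ x → u⊑v x ∘ w⊑u x)
      ; <-resp-≈      = resp₂ _⊏_
      }

  maximal-above : ∀ v → ∃ λ u → v ⊑ u × Maximal u
  maximal-above v = go v (spo-noetherian ⊏-isStrictPartialOrder v)
    where
    go : ∀ v → Acc (flip _⊏_) v → ∃ λ u → v ⊑ u × Maximal u
    go v (acc rs) with any? (λ u → (v ⊑? u) ×-dec ¬? (u ⊑? v))
    ... | no ¬found = v , (λ _ → id) , λ u v⊑u →
      decidable-stable (u ⊑? v) (λ u⋢v → ¬found (u , v⊑u , u⋢v))
    ... | yes (u , v⊏u) with go u (rs v⊏u)
    ...   | w , u⊑w , max = w , (λ x → u⊑w x ∘ proj₁ v⊏u x) , max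

  -- Excluding the four-cycle, the bull and the hammer.

  module WithoutC₄ (¬C₄ : ¬ InducedCopy (C 4) G) where

    no-C₄ : ∀ {a b c d} → a ~ b → b ~ c → c ~ d → d ~ a → c ∉N[ a ] → d ∉N[ b ] → ⊥
    no-C₄ {a} {b} {c} {d} ab bc cd da c∉a d∉b = ¬C₄
      (copy G (C 4) (Vec.lookup (a ∷ b ∷ c ∷ d ∷ []))
        ( (ab ∷ (∉N⇒≢ c∉a , ∉N⇒≁ c∉a) ∷ symm da ∷ [])
        ∷ (bc ∷ (∉N⇒≢ d∉b , ∉N⇒≁ d∉b) ∷ [])
        ∷ (cd ∷ []) ∷ [] ∷ [] ))

    -- Otherwise `a b c d` is an induced four-cycle.
    common-neighbours : ∀ {a b c d} → a ~ b → a ~ d → c ~ b → c ~ d → c ∉N[ a ] → d ∈N[ b ]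
    common-neighbours {b = b} {d = d} ab ad cb cd c∉a =
      decidable-stable (d ∈N[ b ]?) (no-C₄ ab (symm cb) cd (symm ad) c∉a)

    -- An edge between the pendant ends `x` and `y` would close the induced four-cycle `a b y x`.
    no-bull : ¬ InducedCopy bull G → ∀ {a b c x y} → a ~ b → b ~ c → c ~ a → a ~ x → b ~ y →
              ¬ b ~ x → ¬ c ~ x → ¬ a ~ y → ¬ c ~ y → ⊥
    no-bull ¬bull {a} {b} {c} {x} {y} ab bc ca ax by b≁x c≁x a≁y c≁y = ¬bull
      (copy G bull (Vec.lookup (a ∷ b ∷ c ∷ x ∷ y ∷ []))
        ( (ab ∷ symm ca ∷ ax ∷ (a≢y , a≁y) ∷ [])
        ∷ (bc ∷ (b≢x , b≁x) ∷ by ∷ [])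
        ∷ ((c≢x , c≁x) ∷ (c≢y , c≁y) ∷ [])
        ∷ ((x≢y , x≁y) ∷ []) ∷ [] ∷ [] ))
      where
      a≢y : a ≢ y
      a≢y refl = c≁y ca
      b≢x : b ≢ x
      b≢x refl = c≁x (symm bc)
      c≢x : c ≢ x
      c≢x refl = b≁x bc
      c≢y : c ≢ y
      c≢y refl = a≁y (symm ca)
      x≢y : x ≢ y
      x≢y refl = a≁y ax
      x≁y : ¬ x ~ y
      x≁y xy = no-C₄ ab by (symm xy) (symm ax) [ a≢y ∘ sym , a≁y ]′ [ b≢x ∘ sym , b≁x ]′

    -- Suppose `e` lies outside N[c]. If `p`, one of `a` and `b`, were adjacent to `e`, then
    -- `c p e d` would be an induced four-cycle; so the five vertices form a hammer.
    no-hammer : ¬ InducedCopy hammer G → ∀ {a b c d e} → a ~ b → b ~ c → c ~ a → c ~ d → d ~ e →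
                ¬ a ~ d → ¬ b ~ d → e ∈N[ c ]
    no-hammer ¬hammer {a} {b} {c} {d} {e} ab bc ca cd de a≁d b≁d =
      decidable-stable (e ∈N[ c ]?) λ e∉c → ¬hammer
      (copy G hammer (Vec.lookup (a ∷ b ∷ c ∷ d ∷ e ∷ []))
        ( (ab ∷ symm ca ∷ (a≢d , a≁d) ∷ (a≢e , ≁e ca a≢d a≁d e∉c) ∷ [])
        ∷ (bc ∷ (b≢d , b≁d) ∷ (b≢e , ≁e (symm bc) b≢d b≁d e∉c) ∷ [])
        ∷ (cd ∷ (∉N⇒≢ e∉c , ∉N⇒≁ e∉c) ∷ [])
        ∷ (de ∷ []) ∷ [] ∷ [] ))
      where
      a≢d : a ≢ d
      a≢d refl = b≁d (symm ab)
      b≢d : b ≢ d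
      b≢d refl = a≁d ab
      a≢e : a ≢ e
      a≢e refl = a≁d (symm de)
      b≢e : b ≢ e
      b≢e refl = b≁d (symm de)
      ≁e : ∀ {p} → c ~ p → p ≢ d → ¬ p ~ d → e ∉N[ c ] → ¬ p ~ e
      ≁e cp p≢d p≁d e∉c pe = no-C₄ cp pe (symm de) (symm cd) e∉c [ p≢d ∘ sym , p≁d ]′

  -- Unseparated graphs with a triangle and no induced four-cycle.

  module Unseparated (¬C₄ : ¬ InducedCopy (C 4) G) (¬sep : ¬ Separation G)
                     {α β γ} (αβ : α ~ β) (βγ : β ~ γ) (γα : γ ~ α) where
    open WithoutC₄ ¬C₄

    another-vertex : ∀ v → ∃ λ u → u ≢ v
    another-vertex v with α ≟ v
    ... | no α≢v  = α , α≢v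
    ... | yes α≡v = β , λ β≡v → ~⇒≢ αβ (trans α≡v (sym β≡v))

    -- An isolated vertex is separated by the empty clique.
    has-neighbour : ∀ v → ∃ λ u → v ~ u
    has-neighbour v with any? (adj? v)
    ... | yes found = found
    ... | no isolated = contradiction (record
      { Q = λ _ → ⊥ ; X? = _≟ v ; Q? = λ _ → no λ () ; inside = v , refl ; outside = another-vertex v
      ; clique = λ () ; complete = λ _ () ; boundary = λ { refl vu → contradiction (_ , vu) isolated }
      }) ¬sep

    -- Otherwise N(v) is separated from the rest by the clique {v}.
    leaves : ∀ v → ∃₂ λ d e → v ~ d × d ~ e × e ∉N[ v ]
    leaves v with any? (λ d → any? λ e → adj? v d ×-dec adj? d e ×-dec ¬? (e ∈N[ v ]?))
    ... | yes found = found
    ... | no closed = contradiction (record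
      { X? = adj? v ; Q? = _≟ v ; inside = has-neighbour v ; outside = v , irrefl refl
      ; clique = λ { refl refl v≢v → contradiction refl v≢v } ; complete = λ { vu refl → symm vu }
      ; boundary = λ {u} {w} vu uw →
          Sum.swap (decidable-stable (w ∈N[ v ]?) (λ w∉ → closed (u , w , vu , uw , w∉)))
      }) ¬sep

    -- A vertex whose neighbourhood is a clique is separated by that neighbourhood.
    non-simplicial : ∀ s → ∃₂ λ p q → s ~ p × s ~ q × q ∉N[ p ]
    non-simplicial s with any? (λ p → any? λ q → adj? s p ×-dec adj? s q ×-dec ¬? (q ∈N[ p ]?))
    ... | yes found = found
    ... | no simplicial = contradiction (record
      { X? = _≟ s ; Q? = adj? s ; inside = s , refl ; outside = another-vertex s
      ; clique = λ {u} {v} su sv u≢v → ∈N∧≢⇒~ (decidable-stable (v ∈N[ u ]?) λ v∉u →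
          simplicial (u , v , su , sv , v∉u)) u≢v
      ; complete = λ { refl sv → sv } ; boundary = λ { refl → inj₂ }
      }) ¬sep

    -- The hammer-free case.

    module Hammer-free (¬hammer : ¬ InducedCopy hammer G) where
      hammer-free : ∀ {a b c d e} → a ~ b → b ~ c → c ~ a → c ~ d → d ~ e →
                    ¬ a ~ d → ¬ b ~ d → e ∈N[ c ]
      hammer-free = no-hammer ¬hammer

      -- A maximal vertex above `α` has `α` and `β` in its closed neighbourhood: it is one of them
      -- or forms a triangle with them.
      maximal-in-triangle : ∃ λ v → Maximal v × ∃₂ λ p q → v ~ p × v ~ q × p ~ q
      maximal-in-triangle with maximal-above α
      ... | v , α⊑v , max with α⊑v α (inj₁ refl) | α⊑v β (inj₂ αβ)
      ...   | inj₁ refl | _         = v , max , β , γ , αβ , symm γα , βγ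
      ...   | inj₂ vα   | inj₂ vβ   = v , max , α , β , vα , vβ , αβ
      ...   | inj₂ vα   | inj₁ refl = v , max , α , γ , vα , βγ , symm γα

      module _ {v} (max : Maximal v) {p q} (vp : v ~ p) (vq : v ~ q) (pq : p ~ q) where

        -- Otherwise the triangle `a b v` and the path `v d e` form a hammer.
        edge-meets : ∀ {d e} → v ~ d → d ~ e → e ∉N[ v ] → ∀ {a b} → v ~ a → v ~ b → a ~ b →
                     a ∈N[ d ] ⊎ b ∈N[ d ]
        edge-meets {d} vd de e∉v {a} {b} va vb ab with a ∈N[ d ]? | b ∈N[ d ]?
        ... | yes a∈ | _      = inj₁ a∈
        ... | no _   | yes b∈ = inj₂ b∈
        ... | no a∉  | no b∉  = contradiction
          (hammer-free ab (symm vb) va vd de (∉N⇒≁ a∉ ∘ symm) (∉N⇒≁ b∉ ∘ symm)) e∉v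

        -- Two non-adjacent neighbours of `e` cannot both lie in N[v], since with `v` and `e` they
        -- would form an induced four-cycle.
        neighbour-outside : ∀ {e} → e ∉N[ v ] → ∃ λ f → e ~ f × f ∉N[ v ]
        neighbour-outside {e} e∉v with non-simplicial e
        ... | x , y , ex , ey , y∉x with x ∈N[ v ]? | y ∈N[ v ]?
        ...   | no x∉  | _      = x , ex , x∉
        ...   | yes _  | no y∉  = y , ey , y∉
        ...   | yes x∈ | yes y∈ =
          contradiction (common-neighbours (v~ ex x∈) (v~ ey y∈) ex ey e∉v) y∉x
          where
          v~ : ∀ {x} → e ~ x → x ∈N[ v ] → v ~ x
          v~ ex x∈ = ∈N∧≢⇒~ x∈ λ { refl → e∉v (inj₂ (symm ex)) }

        -- Otherwise N[e] ⊆ N[d], and a neighbour f of e outside N[v] yields a triangle d e f that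
        -- forces N[v] ⊆ N[d], against the maximality of v.
        common⇒~e : ∀ {d e} → v ~ d → d ~ e → e ∉N[ v ] → ∀ {a} → v ~ a → d ~ a → a ~ e
        common⇒~e {d} {e} vd de e∉v {a} va da = decidable-stable (adj? a e) λ a≁e →
          let (f , ef , f∉v) = neighbour-outside e∉v
              f∈d = hammer-free (symm va) vd da de ef a≁e (∉N⇒≁ e∉v)
              df  = ∈N∧≢⇒~ f∈d λ d≡f → f∉v (subst (_∈N[ v ]) d≡f (inj₂ vd))
              v⊑d = λ
                { x (inj₁ refl) → inj₂ (symm vd)
                ; x (inj₂ vx)   → hammer-free ef (symm df) de (symm vd) vx
                                    (∉N⇒≁ e∉v ∘ symm) (∉N⇒≁ f∉v ∘ symm) }
          in e∉v (max d v⊑d e (inj₂ de))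

        contradictory : ⊥
        contradictory with leaves v
        -- Once N[v] is contained in N[d], maximality of `v` puts `e` into N[v].
        ... | d , e , vd , de , e∉v = e∉v (max d v⊑d e (inj₂ de))
          where
          -- As the edge `s r` meets N[d], `r` would be adjacent to `d`. Applying `common⇒~e` twice
          -- makes first `r` and then `s` adjacent to `e`, so `v d e s` is an induced four-cycle.
          isolated-in-N[v] : ∀ {s r} → v ~ s → s ∉N[ d ] → v ~ r → ¬ s ~ r
          isolated-in-N[v] {s} {r} vs s∉d vr sr with edge-meets vd de e∉v vs vr sr
          ... | inj₁ s∈d = s∉d s∈d
          ... | inj₂ (inj₁ refl) = s∉d (inj₂ (symm sr))
          ... | inj₂ (inj₂ dr) = s∉d (common-neighbours vd vs (symm de)
            (symm (common⇒~e vr (common⇒~e vd de e∉v vr dr) e∉v vs (symm sr))) e∉v)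

          -- Either s has no neighbour outside N[v], and then s is not simplicial, or the edge p q
          -- meets N[s].
          N[v]-neighbour : ∀ {s} → v ~ s → ∃ λ r → v ~ r × s ~ r
          N[v]-neighbour {s} vs with any? (λ e′ → adj? s e′ ×-dec ¬? (e′ ∈N[ v ]?))
          ... | yes (e′ , se′ , e′∉v) with edge-meets vs se′ e′∉v vp vq pq
          ...   | inj₁ (inj₁ refl) = q , vq , pq
          ...   | inj₁ (inj₂ sp)   = p , vp , sp
          ...   | inj₂ (inj₁ refl) = p , vp , symm pq
          ...   | inj₂ (inj₂ sq)   = q , vq , sq
          N[v]-neighbour {s} vs | no s⊑v with non-simplicial s
          ... | x , y , sx , sy , y∉x = x , ∈N∧≢⇒~ (stays sx) (λ { refl → y∉x (stays sy) }) , sx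
            where
            stays : ∀ {x} → s ~ x → x ∈N[ v ]
            stays {x} sx = decidable-stable (x ∈N[ v ]?) λ x∉ → s⊑v (x , sx , x∉)

          v⊑d : v ⊑ d
          v⊑d s (inj₁ refl) = inj₂ (symm vd)
          v⊑d s (inj₂ vs) = decidable-stable (s ∈N[ d ]?) λ s∉d →
            let (r , vr , sr) = N[v]-neighbour vs in isolated-in-N[v] vs s∉d vr sr

      separated : ⊥
      separated with maximal-in-triangle
      ... | v , max , p , q , vp , vq , pq = contradictory max vp vq pq

    -- The bull-free case: twins.

    module Bull-free (¬bull : ¬ InducedCopy bull G) where
      bull-free : ∀ {a b c x y} → a ~ b → b ~ c → c ~ a → a ~ x → b ~ y →
              ¬ b ~ x → ¬ c ~ x → ¬ a ~ y → ¬ c ~ y → ⊥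
      bull-free = no-bull ¬bull

      Private : V → V → V → Set
      Private v d x = v ~ x × x ∉N[ d ]

      -- Common neighbours are sorted by whose private neighbours they see. For incomparable maximal
      -- `v` and `d`, the side of `v` consists of twins of `v`; see `side-twin`.
      Side : V → V → V → Set
      Side v d a = v ~ a × d ~ a × ∀ x → Private v d x → a ~ x

      side? : ∀ v d → Decidable₁ (Side v d)
      side? v d a = adj? v a ×-dec adj? d a ×-dec
        (all? λ x → (adj? v x ×-dec ¬? (x ∈N[ d ]?)) →-dec adj? a x)

      -- Both `a` and `b` are common neighbours of `d` and a private neighbour of `v`, which are not
      -- adjacent.
      side⇒∈N[] : ∀ {v d} → ¬ v ⊑ d → v ~ d → ∀ {a b} → Side v d a → Side v d b → b ∈N[ a ]
      side⇒∈N[] v⋢d vd (va , da , a-X) (vb , db , b-X) with ⊑-witness-~ vd v⋢d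
      ... | x , vx , x∉d =
        common-neighbours da db (symm (a-X x (vx , x∉d))) (symm (b-X x (vx , x∉d))) x∉d

      Incomparable : V → V → Set
      Incomparable v d = Maximal v × Maximal d × v ~ d × ¬ v ⊑ d × ¬ d ⊑ v

      Incomparable-sym : ∀ {v d} → Incomparable v d → Incomparable d v
      Incomparable-sym (mv , md , vd , v⋢d , d⋢v) = md , mv , symm vd , d⋢v , v⋢d

      -- Otherwise `a` misses a private neighbour of `v` and one of `d`, and these hang off the
      -- triangle `v d a` as a bull.
      two-sides : ∀ {v d} → v ~ d → ∀ {a} → v ~ a → d ~ a → Side v d a ⊎ Side d v a
      two-sides {v} {d} vd {a} va da with side? v d a | side? d v a
      ... | yes s | _     = inj₁ s
      ... | no _  | yes s = inj₂ s
      ... | no ¬s | no ¬t with missed va da ¬s | missed da va ¬t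
        where
        missed : ∀ {v d} → v ~ a → d ~ a → ¬ Side v d a → ∃ λ x → Private v d x × ¬ a ~ x
        missed {v} {d} va da ¬s with any? (λ x → (adj? v x ×-dec ¬? (x ∈N[ d ]?)) ×-dec ¬? (adj? a x))
        ... | yes found = found
        ... | no ¬found = contradiction (va , da , λ x x∈ →
          decidable-stable (adj? a x) λ a≁x → ¬found (x , x∈ , a≁x)) ¬s
      ... | x , (vx , x∉d) , a≁x | y , (dy , y∉v) , a≁y = ⊥-elim
        (bull-free vd da (symm va) vx dy (∉N⇒≁ x∉d) a≁x (∉N⇒≁ y∉v) a≁y)

      -- A neighbour y of a that is private to d makes a dominate v: an element b of the other side
      -- outside N[a] would close the four-cycle y a v b.
      side-≁-private : ∀ {v d} → Incomparable v d → ∀ {a y} → Side v d a → Private d v y → ¬ a ~ y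
      side-≁-private {v} {d} (mv , md , vd , v⋢d , d⋢v) {a} {y} s@(va , da , a-X) (dy , y∉v) ay =
        y∉v (mv a v⊑a y (inj₂ ay))
        where
        v⊑a : v ⊑ a
        v⊑a u (inj₁ refl) = inj₂ (symm va)
        v⊑a u (inj₂ vu) with u ∈N[ d ]?
        ... | no u∉d = inj₂ (a-X u (vu , u∉d))
        ... | yes (inj₁ refl) = inj₂ (symm da)
        ... | yes (inj₂ du) with two-sides vd vu du
        ...   | inj₁ t = side⇒∈N[] v⋢d vd s t
        ...   | inj₂ (_ , _ , u-Y) = common-neighbours va vu (symm ay) (symm (u-Y y (dy , y∉v))) y∉v

      -- Let `u` be a neighbour of `a` outside N[v] and `e` a private neighbour of `d`. If `d`
      -- misses `u`, the triangle `a d v` with pendants `u` and `e` is a bull; otherwise `u` is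
      -- private to `d`, against `side-≁-private`.
      side-⊑ : ∀ {v d} → Incomparable v d → ∀ {a} → Side v d a → a ⊑ v
      side-⊑ _ (va , _) u (inj₁ refl) = inj₂ va
      side-⊑ {v} {d} inc@(mv , md , vd , v⋢d , d⋢v) {a} s@(va , da , _) u (inj₂ au) =
        decidable-stable (u ∈N[ v ]?) λ u∉v →
          let (e , de , e∉v) = ⊑-witness-~ (symm vd) d⋢v
              du = decidable-stable (adj? d u) λ d≁u →
                bull-free (symm da) (symm vd) va au de d≁u (∉N⇒≁ u∉v)
                  (side-≁-private inc s (de , e∉v)) (∉N⇒≁ e∉v)
          in side-≁-private inc s (du , u∉v) au

      -- A non-adjacent pair keeps the private neighbours of v inside N[v] by bull-freeness, so they
      -- are separated from the rest by the clique formed by v and its side.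
      sides-adjacent : ∀ {v d} → Incomparable v d → ∀ {a b} → Side v d a → Side d v b → b ∈N[ a ]
      sides-adjacent {v} {d} inc@(mv , md , vd , v⋢d , d⋢v) {a} {b} s@(va , da , a-X) t@(db , vb , _) =
        decidable-stable (b ∈N[ a ]?) λ b∉a → ¬sep (separation b∉a)
        where
        confined : b ∉N[ a ] → ∀ {x p} → Private v d x → x ~ p → p ∈N[ v ]
        confined b∉a {x} {p} X@(vx , x∉d) xp = decidable-stable (p ∈N[ v ]?) λ p∉v →
          -- The bull is the triangle `x v a` with `p` pendant at `x` and `b` pendant at `v`.
          bull-free (symm vx) va (a-X x X) xp vb (∉N⇒≁ p∉v) (p∉v ∘ side-⊑ inc s p ∘ inj₂)
            (side-≁-private (Incomparable-sym inc) t X ∘ symm) (∉N⇒≁ b∉a)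

        separation : b ∉N[ a ] → Separation G
        separation b∉a = record
          { X?       = λ x → adj? v x ×-dec ¬? (x ∈N[ d ]?)
          ; Q?       = λ u → (u ≟ v) ⊎-dec side? v d u
          ; inside   = ⊑-witness-~ vd v⋢d
          ; outside  = v , irrefl refl ∘ proj₁
          ; clique   = λ
            { (inj₁ refl) (inj₁ refl) v≢v → contradiction refl v≢v
            ; (inj₁ refl) (inj₂ (vu , _)) _ → vu
            ; (inj₂ (vu , _)) (inj₁ refl) _ → symm vu
            ; (inj₂ S) (inj₂ T) u≢w → ∈N∧≢⇒~ (side⇒∈N[] v⋢d vd S T) u≢w }
          ; complete = λ
            { (vu , _) (inj₁ refl) → symm vu
            ; X (inj₂ (_ , _ , w-X)) → symm (w-X _ X) }
          ; boundary = λ {x} {p} → boundary x p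
          }
          where
          boundary : ∀ x p → Private v d x → x ~ p → Private v d p ⊎ (p ≡ v ⊎ Side v d p)
          boundary x p X xp with confined b∉a X xp
          ... | inj₁ p≡v = inj₂ (inj₁ p≡v)
          ... | inj₂ vp with p ∈N[ d ]?
          ...   | no p∉d = inj₁ (vp , p∉d)
          ...   | yes (inj₁ refl) = contradiction (inj₂ (symm xp)) (proj₂ X)
          ...   | yes (inj₂ dp) with two-sides vd vp dp
          ...     | inj₁ S = inj₂ (inj₂ S)
          ...     | inj₂ T = contradiction (symm xp) (side-≁-private (Incomparable-sym inc) T X)

      -- Private neighbours of `v` see `a` by definition, common neighbours by `side⇒∈N[]` or
      -- `sides-adjacent`, depending on their side.
      side-twin : ∀ {v d} → Incomparable v d → ∀ {a} → Side v d a → Twins a v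
      side-twin {v} {d} inc@(mv , md , vd , v⋢d , d⋢v) {a} s@(va , da , a-X) = side-⊑ inc s , v⊑a
        where
        v⊑a : v ⊑ a
        v⊑a u (inj₁ refl) = inj₂ (symm va)
        v⊑a u (inj₂ vu) with u ∈N[ d ]?
        ... | no u∉d = inj₂ (a-X u (vu , u∉d))
        ... | yes (inj₁ refl) = inj₂ (symm da)
        ... | yes (inj₂ du) with two-sides vd vu du
        ...   | inj₁ t = side⇒∈N[] v⋢d vd s t
        ...   | inj₂ t = sides-adjacent inc s t

      common-twin : ∀ {v d} → Maximal v → Maximal d → v ~ d → ¬ d ⊑ v →
                    ∀ {a} → v ~ a → d ~ a → Twins a v ⊎ Twins a d
      common-twin mv md vd d⋢v va da =
        Sum.map (side-twin inc) (side-twin (Incomparable-sym inc)) (two-sides vd va da)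
        where inc = mv , md , vd , d⋢v ∘ mv _ , d⋢v

      Twins⇒Maximal : ∀ {u v} → Twins u v → Maximal v → Maximal u
      Twins⇒Maximal (u⊑v , v⊑u) mv w u⊑w x = v⊑u x ∘ mv w (λ y → u⊑w y ∘ v⊑u y) x

      -- If a maximal `d` above `u` differs from `u`, then `u` is a common neighbour of `v` and `d`,
      -- hence a twin of one of them, and not of `v`.
      neighbour-maximal : ∀ {v u} → Maximal v → v ~ u → ¬ u ⊑ v → Maximal u
      neighbour-maximal {v} {u} mv vu u⋢v with maximal-above u
      ... | d , u⊑d , md with u⊑d u (inj₁ refl)
      ...   | inj₁ refl = md
      ...   | inj₂ du with u⊑d v (inj₂ (symm vu))
      ...     | inj₁ refl = contradiction u⊑d u⋢v
      ...     | inj₂ dv with common-twin mv md (symm dv) (λ d⊑v → u⋢v λ x → d⊑v x ∘ u⊑d x) vu du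
      ...       | inj₁ (u⊑v , _) = contradiction u⊑v u⋢v
      ...       | inj₂ twins = Twins⇒Maximal twins md

      -- The properly dominated neighbours of v are separated from the rest by the twins of v.
      neighbour-undominated : ∀ {v u} → Maximal v → v ~ u → u ⊑ v → v ⊑ u
      neighbour-undominated {v} {u} mv vu u⊑v = decidable-stable (v ⊑? u) λ v⋢u → ¬sep record
        { X?       = λ x → adj? v x ×-dec (x ⊑? v) ×-dec ¬? (v ⊑? x)
        ; Q?       = λ q → (q ⊑? v) ×-dec (v ⊑? q)
        ; inside   = u , vu , u⊑v , v⋢u
        ; outside  = v , irrefl refl ∘ proj₁
        ; clique   = λ (p⊑v , v⊑p) (q⊑v , v⊑q) p≢q → ∈N∧≢⇒~ (v⊑p _ (q⊑v _ (inj₁ refl))) p≢q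
        ; complete = λ (vx , _ , v⋢x) (_ , v⊑q) →
            symm (∈N∧≢⇒~ (v⊑q _ (inj₂ vx)) λ { refl → v⋢x v⊑q })
        ; boundary = λ {x} {p} → boundary x p
        }
        where
        boundary : ∀ x p → v ~ x × x ⊑ v × ¬ v ⊑ x → x ~ p →
                   (v ~ p × p ⊑ v × ¬ v ⊑ p) ⊎ Twins p v
        boundary x p (vx , x⊑v , v⋢x) xp with p ⊑? v | v ⊑? p | x⊑v p (inj₂ xp)
        ... | yes p⊑v | yes v⊑p | _ = inj₂ (p⊑v , v⊑p)
        ... | yes p⊑v | no v⋢p | inj₂ vp = inj₁ (vp , p⊑v , v⋢p)
        ... | yes p⊑v | no v⋢p | inj₁ refl = contradiction (λ _ → id) v⋢p
        ... | no p⋢v | _ | inj₁ refl = contradiction (λ _ → id) p⋢v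
        -- Here `p` would be maximal, so its common neighbour `x` with `v` is a twin of `v` or `p`;
        -- but `x` is properly below `v`, and `p` is not below `v`.
        ... | no p⋢v | _ | inj₂ vp with common-twin mv (neighbour-maximal mv vp p⋢v) vp p⋢v vx (symm xp)
        ...   | inj₁ (_ , v⊑x) = contradiction v⊑x v⋢x
        ...   | inj₂ (_ , p⊑x) = contradiction (λ y → x⊑v y ∘ p⊑x y) p⋢v

      all-maximal : ∀ u → Maximal u
      all-maximal u with maximal-above u
      ... | v , u⊑v , mv with u⊑v u (inj₁ refl)
      ...   | inj₁ refl = mv
      ...   | inj₂ vu = Twins⇒Maximal (u⊑v , neighbour-undominated mv vu u⊑v) mv

      ⊑⇒Twins : ∀ {u v} → u ⊑ v → Twins u v
      ⊑⇒Twins {u} {v} u⊑v = u⊑v , all-maximal u v u⊑v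

      -- As all vertices are maximal, `a` and `b` are twins or incomparable; in the latter case
      -- `common-twin` applies to `c`.
      triangle-twins : ∀ {a b c} → a ~ b → b ~ c → c ~ a → Twins a b ⊎ Twins c a ⊎ Twins c b
      triangle-twins {a} {b} ab bc ca with b ⊑? a
      ... | yes b⊑a = inj₁ (all-maximal b a b⊑a , b⊑a)
      ... | no b⋢a = inj₂ (common-twin (all-maximal a) (all-maximal b) ab b⋢a (symm ca) bc)

      non-twin-neighbour : ∀ v → ∃ λ u → v ~ u × ¬ Twins u v
      non-twin-neighbour v with leaves v
      ... | d , e , vd , de , e∉v = d , vd , λ (d⊑v , _) → e∉v (d⊑v e (inj₂ de))

      -- The member of smallest index represents its twin class.
      Least : V → Set
      Least v = ∀ u → Twins u v → ¬ u <ᶠ v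

      twins? : ∀ u v → Dec (Twins u v)
      twins? u v = (u ⊑? v) ×-dec (v ⊑? u)

      least? : Decidable₁ Least
      least? v = all? λ u → twins? u v →-dec ¬? (u <? v)

      least-twin : ∀ v → ∃ λ r → Twins r v × Least r
      least-twin v = go v (<ᶠ-wellFounded v)
        where
        go : ∀ v → Acc _<ᶠ_ v → ∃ λ r → Twins r v × Least r
        go v (acc rs) with any? (λ u → twins? u v ×-dec (u <? v))
        ... | no ¬found = v , ((λ _ → id) , λ _ → id) , λ u twins u<v → ¬found (u , twins , u<v)
        ... | yes (u , (u⊑v , v⊑u) , u<v) with go u (rs u<v)
        ...   | r , (r⊑u , u⊑r) , least = r , ((λ x → u⊑v x ∘ r⊑u x) , λ x → u⊑r x ∘ v⊑u x) , least

      Least-twins⇒≡ : ∀ {u v} → Least u → Least v → Twins u v → u ≡ v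
      Least-twins⇒≡ {u} {v} lu lv twins@(u⊑v , v⊑u) with <-cmp u v
      ... | tri< u<v _ _ = contradiction u<v (lv u twins)
      ... | tri≈ _ u≡v _ = u≡v
      ... | tri> _ _ v<u = contradiction v<u (lu v (v⊑u , u⊑v))

      Least-triangle-free : ∀ {a b c} → Least a → Least b → Least c → a ~ b → b ~ c → c ~ a → ⊥
      Least-triangle-free la lb lc ab bc ca with triangle-twins ab bc ca
      ... | inj₁ twins = ~⇒≢ ab (Least-twins⇒≡ la lb twins)
      ... | inj₂ (inj₁ twins) = ~⇒≢ ca (Least-twins⇒≡ lc la twins)
      ... | inj₂ (inj₂ twins) = ~⇒≢ bc (sym (Least-twins⇒≡ lc lb twins))

      -- A clique without least twins extends by those of its vertex v and of a neighbour u of v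
      -- that is not a twin of v, where u is taken inside the clique if possible.
      clique-extension : ∀ {v l} → AllPairs _~_ (v ∷ l) → All (λ x → ¬ Least x) (v ∷ l) →
                         ∃₂ λ r s → AllPairs _~_ (r ∷ s ∷ v ∷ l)
      clique-extension {v} {l} K ¬least = extend split
        where
        Dominated : V → Set
        Dominated u = All (_∈N[ u ]) (v ∷ l)

        within : ∀ {u} → u ∈ v ∷ l → Dominated u
        within {u} u∈ = All.tabulate λ {x} x∈ → decidable-stable (x ∈N[ u ]?) λ x∉ →
          ∉N⇒≁ x∉ (clique-adjacent {G} K u∈ x∈ (∉N⇒≢ x∉))

        split : ∃ λ u → u ∈N[ v ] × ¬ Twins u v × Dominated u
        split with Any.any? (λ u → ¬? (twins? u v)) (v ∷ l)
        ... | yes non-twin = let (u , u∈ , ¬t) = find non-twin in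
          u , All.lookup (within (here refl)) u∈ , ¬t , within u∈
        -- Now the clique consists of twins of `v`, so every neighbour of `v` has the whole clique
        -- in its closed neighbourhood.
        ... | no ¬non-twin with non-twin-neighbour v
        ...   | u , vu , ¬t = u , inj₂ vu , ¬t , All.map
          (λ {x} ¬¬t → ∈N-sym (proj₂ (decidable-stable (twins? x v) ¬¬t) u (inj₂ vu)))
          (Allₚ.¬Any⇒All¬ _ ¬non-twin)

        joins : ∀ {r u} → Twins r u → Least r → Dominated u → All (r ~_) (v ∷ l)
        -- `r` differs from all clique members because none of them is least.
        joins (_ , u⊑r) least dom = All.zipWith
          (λ (x∈u , ¬x) → ∈N∧≢⇒~ (u⊑r _ x∈u) λ { refl → ¬x least }) (dom , ¬least)

        extend : (∃ λ u → u ∈N[ v ] × ¬ Twins u v × Dominated u) → _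
        extend (u , u∈v , ¬t , dom) with least-twin v | least-twin u
        ... | r , tr@(r⊑v , v⊑r) , lr | s , ts@(s⊑u , u⊑s) , ls =
          r , s , (rs ∷ joins tr lr (within (here refl))) ∷ joins ts ls dom ∷ K
          where
          rs : r ~ s
          -- If `r` and `s` coincided, `u` and `v` would be twins.
          rs = ∈N∧≢⇒~ (∈N-sym (u⊑s r (∈N-sym (v⊑r u u∈v)))) λ
            { refl → ¬t ((λ x → r⊑v x ∘ u⊑s x) , λ x → s⊑u x ∘ v⊑r x) }

-- Induction over separations.

triangle? : ∀ G → Dec (Triangle G)
triangle? G = any? λ a → any? λ b → any? λ c → adj? a b ×-dec adj? b c ×-dec adj? c a
  where open Graph G using (adj?)

C₃-copy⇒Triangle : ∀ {G} → InducedCopy (C 3) G → Triangle G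
C₃-copy⇒Triangle c = to (# 0) , to (# 1) , to (# 2)
  , Equivalence.to (adj⇔ _ _) (from-yes (Graph.adj? (C 3) (# 0) (# 1)))
  , Equivalence.to (adj⇔ _ _) (from-yes (Graph.adj? (C 3) (# 1) (# 2)))
  , Equivalence.to (adj⇔ _ _) (from-yes (Graph.adj? (C 3) (# 2) (# 0)))
  where open InducedCopy c

InducedColorable : (ℕ → ℕ) → Graph → Set₁
InducedColorable f G = ∀ {P : Pred (Vertex G) 0ℓ} (P? : Decidable₁ P) → (∃ λ v → ¬ P v) →
  ∀ w → CliqueBound (induced G P?) w → Colorable (induced G P?) (f w)

module _ (k : ℕ) (f : ℕ → ℕ) (k≤f2 : k ≤ f 2) (f-suc : ∀ w → suc (f w) ≤ f (suc w)) where

  private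
    f-shift : ∀ q w → f w + q ≤ f (w + q)
    f-shift zero    w = ℕ.≤-reflexive (trans (ℕ.+-identityʳ (f w)) (cong f (sym (ℕ.+-identityʳ w))))
    f-shift (suc q) w = begin
      f w + suc q     ≡⟨ ℕ.+-suc (f w) q ⟩
      suc (f w + q)   ≤⟨ s≤s (f-shift q w) ⟩
      suc (f (w + q)) ≤⟨ f-suc (w + q) ⟩
      f (suc (w + q)) ≡⟨ cong f (sym (ℕ.+-suc w q)) ⟩
      f (w + suc q)   ∎
      where open ℕ.≤-Reasoning

  -- For `w ≥ 2` monotonicity gives `k ≤ f w`. The smaller bounds are treated apart: `w = 1`
  -- excludes edges and `w = 0` excludes vertices.
  triangle-free-colorable : ∀ {G w} → Colorable G k → CliqueBound G w → Colorable G (f w)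
  triangle-free-colorable {G} {suc (suc w)} col _ = Colorable-mono G
    (ℕ.≤-trans k≤f2 (ℕ.≤-trans (ℕ.m≤m+n (f 2) w) (f-shift w 2))) col
  triangle-free-colorable {G} {suc zero} _ bound = Colorable-mono G
    (ℕ.≤-trans (s≤s z≤n) (f-suc 0))
    ((λ _ → zero {0}) , λ u v u~v →
      contradiction (bound (u ∷ v ∷ []) ((u~v ∷ []) ∷ [] ∷ [])) λ { (s≤s ()) })
  triangle-free-colorable {G} {zero} _ bound = (λ v → absurd v) , λ u → absurd u
    where
    absurd : ∀ {A : Set} → Vertex G → A
    absurd v = contradiction (bound (v ∷ []) ([] ∷ [])) λ ()

  -- A clique in `X` extends by all of `q`, so the clique bound on `X` drops by the size of `q`;
  -- `f-shift` shows that enough colours remain after discarding those on `q`.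
  separation-colorable : ∀ {G w} → Separation G → InducedColorable f G → CliqueBound G w →
                         Colorable G (f w)
  separation-colorable {G} {w} sep ih bound = Colorable-glue {G} X? q
      (All.map (λ Qv Xv → irrefl refl (complete Xv Qv)) all-Q) fits
      (λ Xu ¬Xv u~v → [ (λ Xv → contradiction Xv ¬Xv) , ∈-filter⁺ Q? (∈-allFin _) ]′ (boundary Xu u~v))
      (ih X? outside (w ∸ length q) X-bound)
      (ih (¬? ∘ X?) (proj₁ inside , λ ¬X → ¬X (proj₂ inside)) w (induced-CliqueBound G (¬? ∘ X?) bound))
    where
    open Separation sep
    open Graph G using (Adj; irrefl; order)

    q : List (Vertex G)
    q = filter Q? (allFin order)

    all-Q : All Q q
    all-Q = Allₚ.all-filter Q? (allFin order)

    q-clique : AllPairs Adj q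
    q-clique = clique-of {G} (Unique-filter⁺ Q? (allFin⁺ order)) all-Q clique

    fits : f (w ∸ length q) + length q ≤ f w
    -- The clique `q` has at most `w` vertices, so the truncated subtraction is exact.
    fits = subst (λ x → f (w ∸ length q) + length q ≤ f x) (ℕ.m∸n+n≡m (bound q q-clique))
      (f-shift (length q) (w ∸ length q))

    X-bound : CliqueBound (induced G X?) (w ∸ length q)
    X-bound l l-clique = subst (_≤ w ∸ length q) (ℕ.m+n∸n≡m (length l) (length q))
      (ℕ.∸-monoˡ-≤ (length q)
      (subst (_≤ w) (trans (length-++ (map (ι G X?) l)) (cong (_+ length q) (length-map (ι G X?) l)))
        (bound (map (ι G X?) l ++ q) (AllPairsₚ.++⁺ (ι-clique G X? l-clique) q-clique
          (Allₚ.map⁺ (All.universal (λ i → All.map (complete (ι-∈ G X? i)) all-Q) l))))))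

  -- Induction on the order; since colourability is decidable, G may be assumed to be unseparated.
  colorable-by-separation : ∀ {Hs} →
    (∀ G → Hs -free G → ¬ Triangle G → Colorable G k) →
    (∀ G → Hs -free G → Triangle G → ¬ Separation G → InducedColorable f G →
      ∀ w → CliqueBound G w → Colorable G (f w)) →
    ∀ G → Hs -free G → ∀ w → CliqueBound G w → Colorable G (f w)
  colorable-by-separation {Hs} base step G = go G (<-wellFounded (Graph.order G))
    where
    go : ∀ G → Acc _<_ (Graph.order G) → Hs -free G → ∀ w → CliqueBound G w → Colorable G (f w)
    go G (acc rs) free w bound with triangle? G
    ... | no ¬t = triangle-free-colorable {G} (base G free ¬t) bound
    ... | yes t = decidable-stable (colorable? G (f w)) λ ¬col → ¬col
      (step G free t (λ sep → ¬col (separation-colorable sep ih bound)) ih w bound)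
      where
      ih : InducedColorable f G
      ih P? (v , ¬p) = go (induced G P?) (rs (order-induced-< G P? ¬p)) (induced-free G P? free)

-- The two bounds on the chromatic number.

χ≤ : ∀ G (f : ℕ → ℕ) → (∀ w → CliqueBound G w → Colorable G (f w)) → χ G ≤ f (ω G)
χ≤ G f col = proj₂ (χ-isChromaticNumber G) _ (col _ ω-CliqueBound)

⌊m+m+n/2⌋ : ∀ m n → ⌊ (m + m) + n /2⌋ ≡ m + ⌊ n /2⌋
⌊m+m+n/2⌋ zero    n = refl
⌊m+m+n/2⌋ (suc m) n rewrite ℕ.+-suc m m = cong suc (⌊m+m+n/2⌋ m n)

2*⌊n/2⌋≤n : ∀ n → 2 * ⌊ n /2⌋ ≤ n
2*⌊n/2⌋≤n n = begin
  2 * ⌊ n /2⌋         ≡⟨ cong (⌊ n /2⌋ +_) (ℕ.+-identityʳ ⌊ n /2⌋) ⟩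
  ⌊ n /2⌋ + ⌊ n /2⌋   ≤⟨ ℕ.+-monoʳ-≤ ⌊ n /2⌋ (ℕ.⌊n/2⌋≤⌈n/2⌉ n) ⟩
  ⌊ n /2⌋ + ⌈ n /2⌉   ≡⟨ ℕ.⌊n/2⌋+⌈n/2⌉≡n n ⟩
  n                   ∎
  where open ℕ.≤-Reasoning

module _ (F : Graph) (k : ℕ) (2≤k : 2 ≤ k)
         (colorable : ∀ G → (F ∷ C 4 ∷ C 3 ∷ []) -free G → Colorable G k) where

  private
    triangle-free : ∀ {H} G → (F ∷ C 4 ∷ H ∷ []) -free G → ¬ Triangle G → Colorable G k
    triangle-free G (¬F ∷ ¬C₄ ∷ _) ¬t = colorable G (¬F ∷ ¬C₄ ∷ ¬t ∘ C₃-copy⇒Triangle ∷ [])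

  hammer-free-bound : ∀ G → (F ∷ C 4 ∷ hammer ∷ []) -free G → χ G ≤ ω G + k ∸ 2
  hammer-free-bound G free = χ≤ G (λ w → w + k ∸ 2)
    (colorable-by-separation k (λ w → w + k ∸ 2) ℕ.≤-refl f-suc triangle-free
      -- Every hammer-free graph reaching this case has a separation, so nothing is left to colour.
      (λ { G (¬F ∷ ¬C₄ ∷ ¬hammer ∷ []) (a , b , c , ab , bc , ca) ¬sep _ _ _ →
        ⊥-elim (Neighbourhoods.Unseparated.Hammer-free.separated G ¬C₄ ¬sep ab bc ca ¬hammer) })
      G free)
    where
    f-suc : ∀ w → suc (w + k ∸ 2) ≤ suc w + k ∸ 2
    -- `2 ≤ k` keeps the subtraction from truncating.
    f-suc w = ℕ.≤-reflexive (sym (ℕ.+-∸-assoc 1 (ℕ.≤-trans 2≤k (ℕ.m≤n+m k w))))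

  bull-free-bound : ∀ G → (F ∷ C 4 ∷ bull ∷ []) -free G → 2 * χ G ≤ k * ω G
  bull-free-bound G free = ℕ.≤-trans
    (ℕ.*-monoʳ-≤ 2 (χ≤ G f (colorable-by-separation k f k≤f2 f-suc triangle-free step G free)))
    (2*⌊n/2⌋≤n (k * ω G))
    where
    f : ℕ → ℕ
    f w = ⌊ k * w /2⌋

    -- The `k` colours spent on the twin representatives are exactly paid for by a drop of two in
    -- the clique bound.
    f-+2 : ∀ w → k + f w ≡ f (suc (suc w))
    f-+2 w = trans (sym (⌊m+m+n/2⌋ k (k * w))) (cong ⌊_/2⌋ (trans (ℕ.+-assoc k k (k * w))
      (sym (trans (ℕ.*-suc k (suc w)) (cong (k +_) (ℕ.*-suc k w))))))

    k≤f2 : k ≤ f 2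
    k≤f2 = subst (k ≤_) (f-+2 0) (ℕ.m≤m+n k (f 0))

    f-suc : ∀ w → suc (f w) ≤ f (suc w)
    f-suc w = ℕ.⌊n/2⌋-mono (subst (2 + k * w ≤_) (sym (ℕ.*-suc k w)) (ℕ.+-monoˡ-≤ (k * w) 2≤k))

    step : ∀ G → (F ∷ C 4 ∷ bull ∷ []) -free G → Triangle G → ¬ Separation G →
           InducedColorable f G → ∀ w → CliqueBound G w → Colorable G (f w)
    step G free@(¬F ∷ ¬C₄ ∷ ¬bull ∷ []) (a , b , c , ab , bc , ca) ¬sep ih w bound =
      subst (Colorable G) (trans (f-+2 (w ∸ 2)) (cong f (ℕ.m+[n∸m]≡n 2≤w)))
        (Colorable-+ {G} least? representatives
          -- The least twin of `a` is missing from the rest, so the induction hypothesis applies.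
          (ih (¬? ∘ least?) (proj₁ rep , λ ¬l → ¬l (proj₂ (proj₂ rep))) (w ∸ 2) rest-bound))
      where
      open Neighbourhoods G
      open Unseparated ¬C₄ ¬sep ab bc ca
      open Bull-free ¬bull

      2≤w : 2 ≤ w
      2≤w = bound (a ∷ b ∷ []) ((ab ∷ []) ∷ [] ∷ [])

      rep : ∃ λ r → Twins r a × Least r
      rep = least-twin a

      representatives : Colorable (induced G least?) k
      representatives = triangle-free (induced G least?) (induced-free G least? free)
        λ (x , y , z , xy , yz , zx) →
          Least-triangle-free (ι-∈ G least? x) (ι-∈ G least? y) (ι-∈ G least? z) xy yz zx

      rest-bound : CliqueBound (induced G (¬? ∘ least?)) (w ∸ 2)
      -- `clique-extension` starts from a vertex of the clique, so the empty clique is treated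
      -- apart.
      rest-bound [] _ = z≤n
      rest-bound (i ∷ l) l-clique =
        ℕ.∸-monoˡ-≤ 2 (subst (λ n → 3 + n ≤ w) (length-map ι′ l) (bound _ K))
        where
        ι′ : Vertex (induced G (¬? ∘ least?)) → V
        ι′ = ι G (¬? ∘ least?)

        K = proj₂ (proj₂ (clique-extension {ι′ i} {map ι′ l} (ι-clique G (¬? ∘ least?) l-clique)
          (Allₚ.map⁺ (All.universal (ι-∈ G (¬? ∘ least?)) (i ∷ l)))))

theorem1p6 : (F : Graph) (k : ℕ) → 2 ≤ k →
    (∀ G → (F ∷ C 4 ∷ C 3 ∷ []) -free G → Colorable G k) →
    (∀ G → (F ∷ C 4 ∷ bull ∷ []) -free G → 2 * χ G ≤ k * ω G) ×
    (∀ G → (F ∷ C 4 ∷ hammer ∷ []) -free G → χ G ≤ ω G + k ∸ 2)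
theorem1p6 F k 2≤k colorable = bull-free-bound F k 2≤k colorable , hammer-free-bound F k 2≤k colorable
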